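{- Let $D=\mathrm{diag}(1,-1,1,-1,\ldots)=(1,-x)$, $\mathbb{F}^{\rm S}=(1,x(1+x))$, $\mathbb{L}^{\rm S}=(1+2x,x(1+x))$, write $D(\mathbb{F}^{\rm S})^{ -1}D=[r_{nj}]_{n,j\ge0}$ and $D(\mathbb{L}^{\rm S})^{ -1}D=[q_{nj}]_{n,j\ge0}$, let $C_m=\frac{1}{m+1}\binom{2m}{m}$ be the Catalan numbers, and use the convention $\binom{a}{ -1}=0$. Then: (a) The $0$-th column of $D(\mathbb{F}^{\rm S})^{ -1}D$ is $[C_0,0,0,\ldots]^T$; and for $j\ge1$, $$r_{nj}=\begin{cases}\displaystyle\sum_{k=0}^{\lfloor (j-1)/2\rfloor}(-1)^k\binom{j-1-k}{k}C_{n-1-k}, & n\ge j,\\ 0,&\text{otherwise},\end{cases}$$ i.e. $r_{nj}=\binom{j-1}{0}C_{n-1}-\binom{j-2}{1}C_{n-2}+\cdots+(-1)^{\lfloor (j-1)/2\rfloor}\binom{\lceil (j-1)/2\rceil}{\lfloor (j-1)/2\rfloor}C_{n-\lceil j/2\rceil}$ for $n\ge j$. (b) The $0$-th column of $D(\mathbb{L}^{\rm S})^{ -1}D$ is $[C_0,2C_1,3C_2,\ldots]^T$ (i.e. $q_{n0}=(n+1)C_n$); for $n\ge1$, $q_{n1}=(2n-1)C_{n-1}$; and for $j\ge2$ and $n\ge j$, $$q_{nj}=\sum_{k=0}^{\lfloor (j-1)/2\rfloor}(-1)^k\left[(n-1-k)\left(\binom{j-1-k}{k}+\binom{j-2-k}{k-1}\right)+\binom{j-2-k}{k-1}\right]C_{n-1-k},$$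 i.e. $q_{nj}=(n-1)C_{n-1}-\left[(n-2)\left(\binom{j-2}{1}+\binom{j-3}{0}\right)+\binom{j-3}{0}\right]C_{n-2}+\left[(n-3)\left(\binom{j-3}{2}+\binom{j-4}{1}\right)+\binom{j-4}{1}\right]C_{n-3}+\cdots+(-1)^{\lfloor (j-1)/2\rfloor}\left[\left(n-\lceil j/2\rceil\right)\left(\binom{\lceil (j-1)/2\rceil}{\lfloor (j-1)/2\rfloor}+\binom{\lceil (j-1)/2\rceil-1}{\lfloor (j-1)/2\rfloor-1}\right)+\binom{\lceil (j-3)/2\rceil}{\lfloor (j-3)/2\rfloor}\right]C_{n-\lceil j/2\rceil}$.
   Context: All matrices are infinite with rows and columns indexed by $0,1,2,\ldots$. For formal power series $g(x)=g_0+g_1x+\cdots$ with $g_0\ne0$ and $f(x)=f_1x+f_2x^2+\cdots$ with $f_1\ne0$, $(g(x),f(x))$ denotes the (Riordan) infinite lower triangular matrix whose $j$-th column has generating function $g(x)f(x)^j$. These matrices form a group under matrix multiplication with $(g,f)(h,l)=(g\cdot h(f),l(f))$. -}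

module Defs where

open import Algebra.Bundles using (Group; CommutativeRing)
open import Data.Integer using (ℤ; +_; -[1+_])
open import Data.Nat as ℕ using (ℕ; zero; suc; z≤n; s≤s)
import Data.Nat.Properties as ℕₚ
open import Data.Product using (_,_)
open import Data.Rational using (ℚ; 0ℚ; 1ℚ; _+_; _*_; _-_; -_; _/_; 1/_; ≢-nonZero)
open import Data.Rational.Properties
open import Data.Rational.Solver using (module +-*-Solver)
open import Data.Sum using (inj₁; inj₂)
open import Level using (0ℓ)
open import Relation.Binary.Definitions using (tri<; tri≈; tri>)
open import Relation.Binary.PropositionalEquality
open import Relation.Nullary using (yes; no; contradiction)

open import Algebra.Properties.Semiring.Exp
  (CommutativeRing.semiring +-*-commutativeRing) public using (_^_)

open ≡-Reasoning

∑< : ℕ → (ℕ → ℚ) → ℚ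
∑< zero    f = 0ℚ
∑< (suc n) f = ∑< n f + f n

∑≤ : ℕ → (ℕ → ℚ) → ℚ
∑≤ n = ∑< (suc n)

infixr 10 ∑< ∑≤
syntax ∑< n (λ k → e) = ∑[ k < n ] e
syntax ∑≤ n (λ k → e) = ∑[ k ≤ n ] e

∑-cong : ∀ n {f g : ℕ → ℚ} → (∀ k → k ℕ.< n → f k ≡ g k) → ∑< n f ≡ ∑< n g
∑-cong zero    eq = refl
∑-cong (suc n) eq =
  cong₂ _+_ (∑-cong n (λ k k<n → eq k (ℕₚ.m<n⇒m<1+n k<n))) (eq n (ℕₚ.n<1+n n))

∑-zero : ∀ n {f : ℕ → ℚ} → (∀ k → k ℕ.< n → f k ≡ 0ℚ) → ∑< n f ≡ 0ℚ
∑-zero zero    eq = refl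
∑-zero (suc n) eq =
  cong₂ _+_ (∑-zero n (λ k k<n → eq k (ℕₚ.m<n⇒m<1+n k<n))) (eq n (ℕₚ.n<1+n n))

∑-+ : ∀ n (f g : ℕ → ℚ) → ∑[ k < n ] (f k + g k) ≡ ∑< n f + ∑< n g
∑-+ zero    f g = refl
∑-+ (suc n) f g = trans (cong (_+ (f n + g n)) (∑-+ n f g))
  (solve 4 (λ a b c d → (a :+ b) :+ (c :+ d) := (a :+ c) :+ (b :+ d)) refl
    (∑< n f) (∑< n g) (f n) (g n))
  where open +-*-Solver

∑-*ˡ : ∀ n c (f : ℕ → ℚ) → c * ∑< n f ≡ ∑[ k < n ] (c * f k)
∑-*ˡ zero    c f = *-zeroʳ c
∑-*ˡ (suc n) c f = trans (*-distribˡ-+ c (∑< n f) (f n)) (cong (_+ c * f n) (∑-*ˡ n c f))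

∑-*ʳ : ∀ n c (f : ℕ → ℚ) → ∑< n f * c ≡ ∑[ k < n ] (f k * c)
∑-*ʳ zero    c f = *-zeroˡ c
∑-*ʳ (suc n) c f = trans (*-distribʳ-+ c (∑< n f) (f n)) (cong (_+ f n * c) (∑-*ʳ n c f))

∑-comm : ∀ m n (f : ℕ → ℕ → ℚ) →
         ∑[ i < m ] ∑[ k < n ] f i k ≡ ∑[ k < n ] ∑[ i < m ] f i k
∑-comm zero    n f = sym (∑-zero n (λ _ _ → refl))
∑-comm (suc m) n f = trans (cong (_+ ∑< n (f m)) (∑-comm m n f))
  (sym (∑-+ n (λ k → ∑[ i < m ] f i k) (f m)))

∑-extend : ∀ {m n} → m ℕ.≤ n → {f : ℕ → ℚ} →
           (∀ k → m ℕ.≤ k → k ℕ.< n → f k ≡ 0ℚ) → ∑< n f ≡ ∑< m f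
∑-extend {zero}  {zero}  _   _ = refl
∑-extend {m} {suc n} m≤1+n {f} f≡0 with ℕₚ.m≤n⇒m<n∨m≡n m≤1+n
... | inj₂ refl = refl
... | inj₁ (s≤s m≤n) = begin
  ∑< n f + f n  ≡⟨ cong₂ _+_ (∑-extend m≤n (λ k m≤k k<n → f≡0 k m≤k (ℕₚ.m<n⇒m<1+n k<n)))
                             (f≡0 n m≤n (ℕₚ.n<1+n n)) ⟩
  ∑< m f + 0ℚ   ≡⟨ +-identityʳ _ ⟩
  ∑< m f        ∎

∑-single : ∀ n {i} → i ℕ.< n → {f : ℕ → ℚ} →
           (∀ k → k ℕ.< n → k ≢ i → f k ≡ 0ℚ) → ∑< n f ≡ f i
∑-single n {i} i<n {f} f≡0 = begin
  ∑< n f        ≡⟨ ∑-extend i<n (λ k i<k k<n → f≡0 k k<n (ℕₚ.>⇒≢ i<k)) ⟩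
  ∑< i f + f i  ≡⟨ cong (_+ f i) (∑-zero i (λ k k<i → f≡0 k (ℕₚ.<-trans k<i i<n) (ℕₚ.<⇒≢ k<i))) ⟩
  0ℚ + f i      ≡⟨ +-identityˡ _ ⟩
  f i           ∎

*-zeroʳ′ : ∀ a {b} → b ≡ 0ℚ → a * b ≡ 0ℚ
*-zeroʳ′ a refl = *-zeroʳ a

*-zeroˡ′ : ∀ b {a} → a ≡ 0ℚ → a * b ≡ 0ℚ
*-zeroˡ′ b refl = *-zeroˡ b

*-≢0 : ∀ {p q} → p ≢ 0ℚ → q ≢ 0ℚ → p * q ≢ 0ℚ
*-≢0 {p} {q} p≢0 q≢0 pq≡0 = q≢0 (begin
  q               ≡⟨ *-identityˡ q ⟨
  1ℚ * q          ≡⟨ cong (_* q) (*-inverseˡ p) ⟨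
  1/ p * p * q    ≡⟨ *-assoc (1/ p) p q ⟩
  1/ p * (p * q)  ≡⟨ cong (1/ p *_) pq≡0 ⟩
  1/ p * 0ℚ       ≡⟨ *-zeroʳ (1/ p) ⟩
  0ℚ              ∎)
  where instance _ = ≢-nonZero p≢0

^-≢0 : ∀ {p} → p ≢ 0ℚ → ∀ n → p ^ n ≢ 0ℚ
^-≢0 p≢0 zero    = 1≢0
^-≢0 p≢0 (suc n) = *-≢0 p≢0 (^-≢0 p≢0 n)

record Triangular : Set where
  field
    entry : ℕ → ℕ → ℚ
    upper : ∀ {n j} → n ℕ.< j → entry n j ≡ 0ℚ
    diag≢0 : ∀ n → entry n n ≢ 0ℚ

open Triangular public

infix 4 _≋_
_≋_ : Triangular → Triangular → Set
A ≋ B = ∀ n j → entry A n j ≡ entry B n j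

diagonal : (d : ℕ → ℚ) → (∀ n → d n ≢ 0ℚ) → Triangular
diagonal d d≢0 = record { entry = e ; upper = u ; diag≢0 = nz }
  where
  e : ℕ → ℕ → ℚ
  e n j with n ℕ.≟ j
  ... | yes _ = d n
  ... | no  _ = 0ℚ

  u : ∀ {n j} → n ℕ.< j → e n j ≡ 0ℚ
  u {n} {j} n<j with n ℕ.≟ j
  ... | yes n≡j = contradiction n≡j (ℕₚ.<⇒≢ n<j)
  ... | no  _   = refl

  nz : ∀ n → e n n ≢ 0ℚ
  nz n with n ℕ.≟ n
  ... | yes _   = d≢0 n
  ... | no  n≢n = contradiction refl n≢n

diagonal-≡ : ∀ d d≢0 n → entry (diagonal d d≢0) n n ≡ d n
diagonal-≡ d d≢0 n with n ℕ.≟ n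
... | yes _   = refl
... | no  n≢n = contradiction refl n≢n

diagonal-≢ : ∀ d d≢0 {n j} → n ≢ j → entry (diagonal d d≢0) n j ≡ 0ℚ
diagonal-≢ d d≢0 {n} {j} n≢j with n ℕ.≟ j
... | yes n≡j = contradiction n≡j n≢j
... | no  _   = refl

I : Triangular
I = diagonal (λ _ → 1ℚ) (λ _ → 1≢0)

-- The sum over all k is finite because row n of A vanishes beyond column n.
infixl 7 _⊡_
_⊡_ : Triangular → Triangular → Triangular
A ⊡ B = record { entry = e ; upper = u ; diag≢0 = nz }
  where
  e : ℕ → ℕ → ℚ
  e n j = ∑[ k ≤ n ] (entry A n k * entry B k j)

  u : ∀ {n j} → n ℕ.< j → e n j ≡ 0ℚ
  u {n} {j} n<j = ∑-zero (suc n) λ k k<1+n →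
    *-zeroʳ′ (entry A n k) (upper B (ℕₚ.≤-trans k<1+n n<j))

  nz : ∀ n → e n n ≢ 0ℚ
  nz n = subst (_≢ 0ℚ) (sym (∑-single (suc n) (ℕₚ.n<1+n n) λ k k<1+n k≢n →
           *-zeroʳ′ (entry A n k) (upper B (ℕₚ.≤∧≢⇒< (ℕ.s≤s⁻¹ k<1+n) k≢n))))
         (*-≢0 (diag≢0 A n) (diag≢0 B n))

-- Forward substitution for A x = b: forward A b n has the first n coordinates
-- of the solution x and is 0 beyond them.
forward : Triangular → (ℕ → ℚ) → ℕ → ℕ → ℚ
forward A b zero    k = 0ℚ
forward A b (suc n) k with k ℕ.≟ n
... | yes _ = (b n - ∑[ i < n ] (entry A n i * forward A b n i))
              * (1/ entry A n n) {{≢-nonZero (diag≢0 A n)}}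
... | no  _ = forward A b n k

solution : Triangular → (ℕ → ℚ) → ℕ → ℚ
solution A b k = forward A b (suc k) k

forward-stable : ∀ A b {n k} → k ℕ.< n → forward A b n k ≡ solution A b k
forward-stable A b {suc n} {k} k<1+n with ℕₚ.m≤n⇒m<n∨m≡n (ℕ.s≤s⁻¹ k<1+n)
... | inj₂ refl = refl
... | inj₁ k<n with k ℕ.≟ n
...   | yes k≡n = contradiction k≡n (ℕₚ.<⇒≢ k<n)
...   | no  _   = forward-stable A b k<n

solution-step : ∀ A b n → solution A b n ≡
  (b n - ∑[ i < n ] (entry A n i * solution A b i)) * (1/ entry A n n) {{≢-nonZero (diag≢0 A n)}}
solution-step A b n with n ℕ.≟ n
... | no n≢n = contradiction refl n≢n
... | yes _  = cong (λ s → (b n - s) * (1/ entry A n n) {{≢-nonZero (diag≢0 A n)}})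
  (∑-cong n (λ i i<n → cong (entry A n i *_) (forward-stable A b i<n)))

solution-solves : ∀ A b n → ∑[ k ≤ n ] (entry A n k * solution A b k) ≡ b n
solution-solves A b n = begin
  s + a * solution A b n    ≡⟨ cong (λ x → s + a * x) (solution-step A b n) ⟩
  s + a * ((b n - s) * a⁻¹) ≡⟨ S.solve 4 (λ s a β a' → s S.:+ a S.:* ((β S.:- s) S.:* a')
                                  S.:= s S.:+ (β S.:- s) S.:* (a S.:* a')) refl s a (b n) a⁻¹ ⟩
  s + (b n - s) * (a * a⁻¹) ≡⟨ cong (λ x → s + (b n - s) * x) (*-inverseʳ a) ⟩
  s + (b n - s) * 1ℚ        ≡⟨ S.solve 2 (λ s β → s S.:+ (β S.:- s) S.:* S.con 1ℚ S.:= β)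
                                  refl s (b n) ⟩
  b n                       ∎
  where
  module S = +-*-Solver
  instance _ = ≢-nonZero (diag≢0 A n)
  s a a⁻¹ : ℚ
  s = ∑[ i < n ] (entry A n i * solution A b i)
  a = entry A n n
  a⁻¹ = 1/ a

solution-zero : ∀ A b {j} → (∀ n → n ℕ.< j → b n ≡ 0ℚ) → ∀ n → n ℕ.< j → solution A b n ≡ 0ℚ
solution-zero A b {j} b≡0 n n<j = go (suc n) n (ℕₚ.n<1+n n) n<j
  where
  go : ∀ m n → n ℕ.< m → n ℕ.< j → solution A b n ≡ 0ℚ
  go (suc m) n (s≤s n≤m) n<j = begin
    solution A b n                       ≡⟨ solution-step A b n ⟩
    (b n - s) * a⁻¹                      ≡⟨ cong₂ (λ x y → (x - y) * a⁻¹) (b≡0 n n<j) s≡0 ⟩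
    (0ℚ - 0ℚ) * a⁻¹                      ≡⟨ *-zeroˡ a⁻¹ ⟩
    0ℚ                                   ∎
    where
    s a⁻¹ : ℚ
    s = ∑[ i < n ] (entry A n i * solution A b i)
    a⁻¹ = (1/ entry A n n) {{≢-nonZero (diag≢0 A n)}}
    s≡0 : s ≡ 0ℚ
    s≡0 = ∑-zero n λ i i<n → *-zeroʳ′ (entry A n i)
      (go m i (ℕₚ.<-≤-trans i<n n≤m) (ℕₚ.<-trans i<n n<j))

-- Column j of the inverse solves A x = (column j of I).
infix 8 _⁻¹
_⁻¹ : Triangular → Triangular
A ⁻¹ = record { entry = e ; upper = u ; diag≢0 = nz }
  where
  col : ℕ → ℕ → ℚ
  col j n = entry I n j

  e : ℕ → ℕ → ℚ
  e n j = solution A (col j) n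

  u : ∀ {n j} → n ℕ.< j → e n j ≡ 0ℚ
  u {n} {j} = solution-zero A (col j) (λ m → upper I {m} {j}) n

  nz : ∀ n → e n n ≢ 0ℚ
  nz n enn≡0 = 1≢0 (begin
    1ℚ                                  ≡⟨ diagonal-≡ _ (λ _ → 1≢0) n ⟨
    entry I n n                         ≡⟨ solution-solves A (col n) n ⟨
    ∑[ k ≤ n ] (entry A n k * e k n)    ≡⟨ ∑-zero (suc n) (λ k k<1+n →
      *-zeroʳ′ (entry A n k) (ekn≡0 k k<1+n)) ⟩
    0ℚ                                  ∎)
    where
    ekn≡0 : ∀ k → k ℕ.< suc n → e k n ≡ 0ℚ
    ekn≡0 k k<1+n with ℕₚ.m≤n⇒m<n∨m≡n (ℕ.s≤s⁻¹ k<1+n)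
    ... | inj₁ k<n  = u k<n
    ... | inj₂ refl = enn≡0

⊡-cong : ∀ {A A′ B B′} → A ≋ A′ → B ≋ B′ → A ⊡ B ≋ A′ ⊡ B′
⊡-cong A≋A′ B≋B′ n j = ∑-cong (suc n) (λ k _ → cong₂ _*_ (A≋A′ n k) (B≋B′ k j))

⊡-assoc : ∀ A B C → (A ⊡ B) ⊡ C ≋ A ⊡ (B ⊡ C)
⊡-assoc A B C n j = begin
  ∑[ k ≤ n ] (∑[ i ≤ n ] (a i * b i k) * c k)    ≡⟨ ∑-cong (suc n) (λ k _ → ∑-*ʳ (suc n) (c k) _) ⟩
  ∑[ k ≤ n ] ∑[ i ≤ n ] (a i * b i k * c k)      ≡⟨ ∑-comm (suc n) (suc n) _ ⟩
  ∑[ i ≤ n ] ∑[ k ≤ n ] (a i * b i k * c k)      ≡⟨ ∑-cong (suc n) inner ⟩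
  ∑[ i ≤ n ] (a i * ∑[ k ≤ i ] (b i k * c k))    ∎
  where
  a : ℕ → ℚ
  a = entry A n
  b : ℕ → ℕ → ℚ
  b = entry B
  c : ℕ → ℚ
  c k = entry C k j
  inner : ∀ i → i ℕ.< suc n →
          ∑[ k ≤ n ] (a i * b i k * c k) ≡ a i * ∑[ k ≤ i ] (b i k * c k)
  inner i i<1+n = begin
    ∑[ k ≤ n ] (a i * b i k * c k)    ≡⟨ ∑-cong (suc n) (λ k _ → *-assoc (a i) (b i k) (c k)) ⟩
    ∑[ k ≤ n ] (a i * (b i k * c k))  ≡⟨ ∑-*ˡ (suc n) (a i) _ ⟨
    a i * ∑[ k ≤ n ] (b i k * c k)    ≡⟨ cong (a i *_) (∑-extend i<1+n (λ k i<k _ →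
      *-zeroˡ′ (c k) (upper B i<k))) ⟩
    a i * ∑[ k ≤ i ] (b i k * c k)    ∎

⊡-identityˡ : ∀ A → I ⊡ A ≋ A
⊡-identityˡ A n j = begin
  ∑[ k ≤ n ] (entry I n k * entry A k j) ≡⟨ ∑-single (suc n) (ℕₚ.n<1+n n) (λ k _ k≢n →
    *-zeroˡ′ (entry A k j) (diagonal-≢ _ (λ _ → 1≢0) (≢-sym k≢n))) ⟩
  entry I n n * entry A n j              ≡⟨ cong (_* entry A n j) (diagonal-≡ _ (λ _ → 1≢0) n) ⟩
  1ℚ * entry A n j                       ≡⟨ *-identityˡ _ ⟩
  entry A n j                            ∎

⊡-identityʳ : ∀ A → A ⊡ I ≋ A
⊡-identityʳ A n j with j ℕ.≤? n
... | yes j≤n = begin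
  ∑[ k ≤ n ] (entry A n k * entry I k j) ≡⟨ ∑-single (suc n) (s≤s j≤n) (λ k _ k≢j →
    *-zeroʳ′ (entry A n k) (diagonal-≢ _ (λ _ → 1≢0) k≢j)) ⟩
  entry A n j * entry I j j              ≡⟨ cong (entry A n j *_) (diagonal-≡ _ (λ _ → 1≢0) j) ⟩
  entry A n j * 1ℚ                       ≡⟨ *-identityʳ _ ⟩
  entry A n j                            ∎
... | no j≰n = trans (upper (A ⊡ I) (ℕₚ.≰⇒> j≰n)) (sym (upper A (ℕₚ.≰⇒> j≰n)))

≋-trans : ∀ {A B C} → A ≋ B → B ≋ C → A ≋ C
≋-trans p q n j = trans (p n j) (q n j)

≋-sym : ∀ {A B} → A ≋ B → B ≋ A
≋-sym p n j = sym (p n j)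

≋-refl : ∀ {A} → A ≋ A
≋-refl n j = refl

⊡-inverseʳ : ∀ A → A ⊡ A ⁻¹ ≋ I
⊡-inverseʳ A n j = solution-solves A (λ m → entry I m j) n

left≋right : ∀ {A B C} → B ⊡ A ≋ I → A ⊡ C ≋ I → B ≋ C
left≋right {A} {B} {C} BA≋I AC≋I =
  ≋-trans {B} {B ⊡ I} {C} (≋-sym {B ⊡ I} {B} (⊡-identityʳ B))
  (≋-trans {B ⊡ I} {B ⊡ (A ⊡ C)} {C} (⊡-cong {B} {B} {I} {A ⊡ C} (≋-refl {B}) (≋-sym {A ⊡ C} {I} AC≋I))
  (≋-trans {B ⊡ (A ⊡ C)} {(B ⊡ A) ⊡ C} {C} (≋-sym {(B ⊡ A) ⊡ C} {B ⊡ (A ⊡ C)} (⊡-assoc B A C))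
  (≋-trans {(B ⊡ A) ⊡ C} {I ⊡ C} {C} (⊡-cong {B ⊡ A} {I} {C} {C} BA≋I (≋-refl {C})) (⊡-identityˡ C))))

⊡-inverseˡ : ∀ A → A ⁻¹ ⊡ A ≋ I
⊡-inverseˡ A = ≋-trans {A ⁻¹ ⊡ A} {A ⁻¹ ⊡ A ⁻¹ ⁻¹} {I}
  (⊡-cong {A ⁻¹} {A ⁻¹} {A} {A ⁻¹ ⁻¹} (≋-refl {A ⁻¹})
    (left≋right {A ⁻¹} {A} {A ⁻¹ ⁻¹} (⊡-inverseʳ A) (⊡-inverseʳ (A ⁻¹))))
  (⊡-inverseʳ (A ⁻¹))

⁻¹-cong : ∀ {A B} → A ≋ B → A ⁻¹ ≋ B ⁻¹
⁻¹-cong {A} {B} A≋B = left≋right {B} {A ⁻¹} {B ⁻¹}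
  (≋-trans {A ⁻¹ ⊡ B} {A ⁻¹ ⊡ A} {I}
    (⊡-cong {A ⁻¹} {A ⁻¹} {B} {A} (≋-refl {A ⁻¹}) (≋-sym {A} {B} A≋B)) (⊡-inverseˡ A))
  (⊡-inverseʳ B)

triangularGroup : Group 0ℓ 0ℓ
triangularGroup = record
  { Carrier = Triangular
  ; _≈_ = _≋_
  ; _∙_ = _⊡_
  ; ε = I
  ; _⁻¹ = _⁻¹
  ; isGroup = record
    { isMonoid = record
      { isSemigroup = record
        { isMagma = record
          { isEquivalence = record
            { refl  = λ {A} → ≋-refl {A}
            ; sym   = λ {A} {B} → ≋-sym {A} {B}
            ; trans = λ {A} {B} {C} → ≋-trans {A} {B} {C}
            }
          ; ∙-cong = λ {A} {A′} {B} {B′} → ⊡-cong {A} {A′} {B} {B′}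
          }
        ; assoc = ⊡-assoc
        }
      ; identity = ⊡-identityˡ , ⊡-identityʳ
      }
    ; inverse = ⊡-inverseˡ , ⊡-inverseʳ
    ; ⁻¹-cong = λ {A} {B} → ⁻¹-cong {A} {B}
    }
  }

-- a n is the coefficient of xⁿ.
Series : Set
Series = ℕ → ℚ

infixl 6 _⊕_
infixl 7 _⊛_ _·_
infixr 8 _⋆_

_⊕_ : Series → Series → Series
(a ⊕ b) n = a n + b n

_·_ : ℚ → Series → Series
(c · a) n = c * a n

_⊛_ : Series → Series → Series
(a ⊛ b) n = ∑[ k ≤ n ] (a k * b (n ℕ.∸ k))

one : Series
one zero    = 1ℚ
one (suc _) = 0ℚ

X : Series
X zero          = 0ℚ
X (suc zero)    = 1ℚ
X (suc (suc _)) = 0ℚ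

_⋆_ : Series → ℕ → Series
a ⋆ zero  = one
a ⋆ suc j = a ⊛ a ⋆ j

⊛-below : ∀ (a b : Series) p q → (∀ k → k ℕ.< p → a k ≡ 0ℚ) → (∀ k → k ℕ.< q → b k ≡ 0ℚ) →
          ∀ n → n ℕ.< p ℕ.+ q → (a ⊛ b) n ≡ 0ℚ
⊛-below a b p q a≡0 b≡0 n n<p+q = ∑-zero (suc n) term
  where
  term : ∀ k → k ℕ.< suc n → a k * b (n ℕ.∸ k) ≡ 0ℚ
  term k k≤n with k ℕ.<? p
  ... | yes k<p = *-zeroˡ′ (b (n ℕ.∸ k)) (a≡0 k k<p)
  ... | no  k≮p = *-zeroʳ′ (a k) (b≡0 (n ℕ.∸ k) n∸k<q)
    where
    n∸k<q : n ℕ.∸ k ℕ.< q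
    n∸k<q = ℕₚ.+-cancelˡ-< k (n ℕ.∸ k) q (subst (ℕ._< k ℕ.+ q) (sym (ℕₚ.m+[n∸m]≡n (ℕ.s≤s⁻¹ k≤n)))
      (ℕₚ.<-≤-trans n<p+q (ℕₚ.+-monoˡ-≤ q (ℕₚ.≮⇒≥ k≮p))))

⊛-lowest : ∀ (a b : Series) p q → (∀ k → k ℕ.< p → a k ≡ 0ℚ) → (∀ k → k ℕ.< q → b k ≡ 0ℚ) →
           (a ⊛ b) (p ℕ.+ q) ≡ a p * b q
⊛-lowest a b p q a≡0 b≡0 = trans
  (∑-single (suc (p ℕ.+ q)) (s≤s (ℕₚ.m≤m+n p q)) term)
  (cong (λ m → a p * b m) (ℕₚ.m+n∸m≡n p q))
  where
  term : ∀ k → k ℕ.< suc (p ℕ.+ q) → k ≢ p → a k * b (p ℕ.+ q ℕ.∸ k) ≡ 0ℚ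
  term k k≤p+q k≢p with ℕₚ.<-cmp k p
  ... | tri< k<p _ _ = *-zeroˡ′ (b (p ℕ.+ q ℕ.∸ k)) (a≡0 k k<p)
  ... | tri≈ _ k≡p _ = contradiction k≡p k≢p
  ... | tri> _ _ p<k = *-zeroʳ′ (a k) (b≡0 _ below)
    where
    below : p ℕ.+ q ℕ.∸ k ℕ.< q
    below = ℕₚ.+-cancelˡ-< k (p ℕ.+ q ℕ.∸ k) q
      (subst (ℕ._< k ℕ.+ q) (sym (ℕₚ.m+[n∸m]≡n (ℕ.s≤s⁻¹ k≤p+q))) (ℕₚ.+-monoˡ-< q p<k))

record IsRiordanPair (g f : Series) : Set where
  field
    g₀≢0 : g 0 ≢ 0ℚ
    f₀≡0 : f 0 ≡ 0ℚ
    f₁≢0 : f 1 ≢ 0ℚ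

riordan : (g f : Series) → IsRiordanPair g f → Triangular
riordan g f gf = record { entry = e ; upper = λ {n} {j} → u {n} {j} ; diag≢0 = nz }
  where
  open IsRiordanPair gf

  e : ℕ → ℕ → ℚ
  e n j = (g ⊛ f ⋆ j) n

  f-below : ∀ k → k ℕ.< 1 → f k ≡ 0ℚ
  f-below zero    _        = f₀≡0
  f-below (suc _) (s≤s ())

  ⋆-below : ∀ j k → k ℕ.< j → (f ⋆ j) k ≡ 0ℚ
  ⋆-below (suc j) k k<1+j = ⊛-below f (f ⋆ j) 1 j f-below (⋆-below j) k k<1+j

  ⋆-lowest : ∀ j → (f ⋆ j) j ≢ 0ℚ
  ⋆-lowest zero    = 1≢0
  ⋆-lowest (suc j) = subst (_≢ 0ℚ) (sym (⊛-lowest f (f ⋆ j) 1 j f-below (⋆-below j)))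
    (*-≢0 f₁≢0 (⋆-lowest j))

  u : ∀ {n j} → n ℕ.< j → e n j ≡ 0ℚ
  u {n} {j} = ⊛-below g (f ⋆ j) 0 j (λ _ ()) (⋆-below j) n

  nz : ∀ n → e n n ≢ 0ℚ
  nz n = subst (_≢ 0ℚ) (sym (⊛-lowest g (f ⋆ n) 0 n (λ _ ()) (⋆-below n)))
    (*-≢0 g₀≢0 (⋆-lowest n))

𝔽ˢ : Triangular
𝔽ˢ = riordan one (X ⊛ (one ⊕ X))
  (record { g₀≢0 = λ () ; f₀≡0 = refl ; f₁≢0 = λ () })

𝕃ˢ : Triangular
𝕃ˢ = riordan (one ⊕ (+ 2 / 1) · X) (X ⊛ (one ⊕ X))
  (record { g₀≢0 = λ () ; f₀≡0 = refl ; f₁≢0 = λ () })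

D : Triangular
D = diagonal (λ n → (- 1ℚ) ^ n) (^-≢0 (λ ()))

D-riordan : D ≋ riordan one ((- 1ℚ) · X)
  (record { g₀≢0 = λ () ; f₀≡0 = refl ; f₁≢0 = λ () })
D-riordan n j = sym (trans (one-⊛ ((- 1ℚ · X) ⋆ j) n) (power j n))
  where
  one-⊛ : ∀ b m → (one ⊛ b) m ≡ b m
  one-⊛ b m = trans
    (∑-single (suc m) (s≤s z≤n) λ { zero _ 0≢0 → contradiction refl 0≢0
                                   ; (suc k) _ _ → *-zeroˡ (b (m ℕ.∸ suc k)) })
    (*-identityˡ (b m))

  -X-⊛ : ∀ b m → ((- 1ℚ · X) ⊛ b) (suc m) ≡ - 1ℚ * b m
  -X-⊛ b m = ∑-single (suc (suc m)) (s≤s (s≤s z≤n))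
    λ { zero _ _ → *-zeroˡ (b (suc m))
      ; (suc zero) _ 1≢1 → contradiction refl 1≢1
      ; (suc (suc k)) _ _ → *-zeroˡ (b (suc m ℕ.∸ suc (suc k))) }

  power : ∀ j n → ((- 1ℚ · X) ⋆ j) n ≡ entry D n j
  power zero    zero    = refl
  power zero    (suc n) = refl
  power (suc j) zero    = trans (+-identityˡ _) (*-zeroˡ (((- 1ℚ · X) ⋆ j) 0))
  power (suc j) (suc n) = trans (-X-⊛ ((- 1ℚ · X) ⋆ j) n) (trans (cong (- 1ℚ *_) (power j n)) shift)
    where
    shift : - 1ℚ * entry D n j ≡ entry D (suc n) (suc j)
    shift with n ℕ.≟ j
    ... | yes refl = sym (diagonal-≡ _ (^-≢0 (λ ())) (suc n))
    ... | no  n≢j  = sym (diagonal-≢ _ (^-≢0 (λ ())) (λ eq → n≢j (ℕₚ.suc-injective eq)))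

open import Data.Nat.Combinatorics using (_C_)

fromℕ : ℕ → ℚ
fromℕ n = + n / 1

catalan : ℕ → ℚ
catalan m = + ((2 ℕ.* m) C m) / suc m

-- Lower index in ℤ, to accommodate binom a (-1) = 0.
binom : ℕ → ℤ → ℕ
binom a (+ k)    = a C k
binom a -[1+ _ ] = 0

{-# OPTIONS --safe #-}

-- Conjugating the inverses by D replaces x(1+x) by x(1-x), whose compositional inverse is xC(x):
-- D(𝔽ˢ)⁻¹D = (1, xC) and D(𝕃ˢ)⁻¹D = (1/√(1-4x), xC). Since (xC)² = xC - x, the entries
-- of both satisfy M(n+1,j+1) = M(n+1,j+2) + M(n,j). Conversely this recurrence makes the product of
-- DMD with any (g, x(1+x)) constant along diagonals, so that only column 0 of the product has to be
-- compared with I. For 𝕃ˢ the entries are binom(2n-j, n), the recurrence being Pascal's rule; for 𝔽ˢ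
-- they are binom(2n-j, n) - 2 binom(2n-j-1, n). The Catalan sums obey the same recurrence, and two
-- consecutive columns determine all later ones.
module Submission where

import Algebra.Properties.Group as GroupProperties
open import Data.Integer as ℤ using (+_)
import Data.Integer.Properties as ℤₚ
open import Data.Nat as ℕ using (ℕ; zero; suc; z≤n; s≤s; ⌊_/2⌋; _∸_; _≤_; _<_)
open import Data.Nat.Combinatorics
  using (_C_; nCn≡1; nC1≡n; nCk≡nC[n∸k]; k>n⇒nCk≡0; nCk+nC[k+1]≡[n+1]C[k+1])
import Data.Nat.Properties as ℕₚ
import Data.Nat.Solver as ℕSolver
open import Data.Product using (_×_; _,_)
open import Data.Rational using (ℚ; 0ℚ; 1ℚ; _+_; _*_; -_; _/_; toℚᵘ)
open import Data.Rational.Properties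
open import Data.Rational.Solver using (module +-*-Solver)
import Data.Rational.Unnormalised as ℚᵘ
import Data.Rational.Unnormalised.Properties as ℚᵘₚ
open import Relation.Binary.PropositionalEquality
  using (_≡_; _≢_; refl; sym; trans; cong; cong₂; subst; module ≡-Reasoning)
open import Relation.Nullary using (yes; no; contradiction)
open import Defs

open ≡-Reasoning

-- Finite sums, binomial coefficients, and naturals as rationals.

∑-suc : ∀ n (f : ℕ → ℚ) → ∑< (suc n) f ≡ f 0 + ∑[ k < n ] f (suc k)
∑-suc zero    f = +-comm 0ℚ (f 0)
∑-suc (suc n) f = trans (cong (_+ f (suc n)) (∑-suc n f))
  (+-assoc (f 0) (∑[ k < n ] f (suc k)) (f (suc n)))

nC0≡1 : ∀ n → n C 0 ≡ 1
nC0≡1 n = trans (nCk≡nC[n∸k] {0} {n} z≤n) (nCn≡1 n)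

pascal-∸ : ∀ {n j} k → j ≤ n → (suc n ∸ j) C suc k ≡ (n ∸ j) C suc k ℕ.+ (n ∸ j) C k
pascal-∸ {n} {j} k j≤n = begin
  (suc n ∸ j) C suc k               ≡⟨ cong (_C suc k) (ℕₚ.+-∸-assoc 1 j≤n) ⟩
  suc (n ∸ j) C suc k               ≡⟨ nCk+nC[k+1]≡[n+1]C[k+1] (n ∸ j) k ⟨
  (n ∸ j) C k ℕ.+ (n ∸ j) C suc k   ≡⟨ ℕₚ.+-comm ((n ∸ j) C k) _ ⟩
  (n ∸ j) C suc k ℕ.+ (n ∸ j) C k   ∎

-- Induction on `n`: Pascal's rule splits the left side, and the two induction hypotheses recombine
-- by Pascal's rule one row lower. Needed to turn binom(2n+1, n+1) into a multiple of the Catalan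
-- number.
absorption : ∀ n k → suc k ℕ.* (suc n C suc k) ≡ suc n ℕ.* (n C k)
absorption zero    zero    = refl
absorption zero    (suc k) = trans
  (cong (suc (suc k) ℕ.*_) (k>n⇒nCk≡0 {1} {suc (suc k)} (s≤s (s≤s z≤n))))
  (trans (ℕₚ.*-zeroʳ (suc (suc k))) (sym (cong (1 ℕ.*_) (k>n⇒nCk≡0 {0} {suc k} (s≤s z≤n)))))
absorption (suc n) zero    = begin
  1 ℕ.* (suc (suc n) C 1)         ≡⟨ ℕₚ.*-identityˡ _ ⟩
  suc (suc n) C 1                 ≡⟨ nC1≡n (suc (suc n)) ⟩
  suc (suc n)                     ≡⟨ ℕₚ.*-identityʳ _ ⟨
  suc (suc n) ℕ.* 1               ≡⟨ cong (suc (suc n) ℕ.*_) (nC0≡1 (suc n)) ⟨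
  suc (suc n) ℕ.* (suc n C 0)     ∎
absorption (suc n) (suc k) = begin
  suc (suc k) ℕ.* (suc (suc n) C suc (suc k))
    ≡⟨ cong (suc (suc k) ℕ.*_) (nCk+nC[k+1]≡[n+1]C[k+1] (suc n) (suc k)) ⟨
  suc (suc k) ℕ.* (x ℕ.+ y)
    ≡⟨ solve 3 (λ c x y → (con 1 :+ c) :* (x :+ y) := (x :+ c :* x) :+ (con 1 :+ c) :* y) refl (suc k) x y ⟩
  (x ℕ.+ suc k ℕ.* x) ℕ.+ suc (suc k) ℕ.* y
    ≡⟨ cong₂ (λ a b → (x ℕ.+ a) ℕ.+ b) (absorption n k) (absorption n (suc k)) ⟩
  (x ℕ.+ suc n ℕ.* (n C k)) ℕ.+ suc n ℕ.* (n C suc k)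
    ≡⟨ solve 4 (λ c x p q → (x :+ c :* p) :+ c :* q := x :+ c :* (p :+ q)) refl (suc n) x (n C k) (n C suc k) ⟩
  x ℕ.+ suc n ℕ.* (n C k ℕ.+ n C suc k)
    ≡⟨ cong (λ p → x ℕ.+ suc n ℕ.* p) (nCk+nC[k+1]≡[n+1]C[k+1] n k) ⟩
  suc (suc n) ℕ.* x
    ∎
  where
  open ℕSolver.+-*-Solver
  x y : ℕ
  x = suc n C suc k
  y = suc n C suc (suc k)

-- `_/_` divides by a gcd and does not reduce on variables, so the equation is checked on
-- unnormalised rationals, where equality means equality of cross products.
fromℕ-+ : ∀ m n → fromℕ (m ℕ.+ n) ≡ fromℕ m + fromℕ n
fromℕ-+ m n = toℚᵘ-injective (ℚᵘₚ.≃-trans (toℚᵘ-fromℚᵘ (ℚᵘ.mkℚᵘ (+ (m ℕ.+ n)) 0))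
  (ℚᵘₚ.≃-trans (ℚᵘ.*≡* (cong (ℤ._* + 1) numerators))
  (ℚᵘₚ.≃-sym (ℚᵘₚ.≃-trans (toℚᵘ-homo-+ (fromℕ m) (fromℕ n))
    (ℚᵘₚ.+-cong (toℚᵘ-fromℚᵘ (ℚᵘ.mkℚᵘ (+ m) 0)) (toℚᵘ-fromℚᵘ (ℚᵘ.mkℚᵘ (+ n) 0)))))))
  where
  numerators : + (m ℕ.+ n) ≡ + m ℤ.* + 1 ℤ.+ + n ℤ.* + 1
  numerators = trans (ℤₚ.pos-+ m n) (sym (cong₂ ℤ._+_ (ℤₚ.*-identityʳ (+ m)) (ℤₚ.*-identityʳ (+ n))))

fromℕ-*-/ : ∀ {a b c} d → a ℕ.* suc d ≡ b ℕ.* c → fromℕ a ≡ fromℕ b * (+ c / suc d)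
fromℕ-*-/ {a} {b} {c} d eq = toℚᵘ-injective (ℚᵘₚ.≃-trans (toℚᵘ-fromℚᵘ (ℚᵘ.mkℚᵘ (+ a) 0))
  (ℚᵘₚ.≃-trans (ℚᵘ.*≡* crossed)
  (ℚᵘₚ.≃-sym (ℚᵘₚ.≃-trans (toℚᵘ-homo-* (fromℕ b) (+ c / suc d))
    (ℚᵘₚ.*-cong (toℚᵘ-fromℚᵘ (ℚᵘ.mkℚᵘ (+ b) 0)) (toℚᵘ-fromℚᵘ (ℚᵘ.mkℚᵘ (+ c) d)))))))
  where
  -- The product of the denominators, `1 * suc d`, reduces to `suc (d + 0)`.
  crossed : + a ℤ.* + suc (d ℕ.+ 0) ≡ + b ℤ.* + c ℤ.* + 1
  crossed = begin
    + a ℤ.* + suc (d ℕ.+ 0)   ≡⟨ cong (λ e → + a ℤ.* + suc e) (ℕₚ.+-identityʳ d) ⟩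
    + a ℤ.* + suc d           ≡⟨ ℤₚ.pos-* a (suc d) ⟨
    + (a ℕ.* suc d)           ≡⟨ cong +_ eq ⟩
    + (b ℕ.* c)               ≡⟨ ℤₚ.pos-* b c ⟩
    + b ℤ.* + c               ≡⟨ ℤₚ.*-identityʳ _ ⟨
    + b ℤ.* + c ℤ.* + 1       ∎

-- Multiplication of power series by x and by x(1+x).

x+x² : Series
x+x² = X ⊛ (one ⊕ X)

shift : Series → Series
shift a zero    = 0ℚ
shift a (suc n) = a n

shift-cong : ∀ {a b} → (∀ n → a n ≡ b n) → ∀ n → shift a n ≡ shift b n
shift-cong a≗b zero    = refl
shift-cong a≗b (suc n) = a≗b n

X-⊛ : ∀ a n → (X ⊛ a) n ≡ shift a n
X-⊛ a zero    = trans (+-identityˡ _) (*-zeroˡ (a 0))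
X-⊛ a (suc n) = trans
  (∑-single (suc (suc n)) (s≤s (s≤s z≤n))
    λ { zero _ _ → *-zeroˡ (a (suc n))
      ; (suc zero) _ 1≢1 → contradiction refl 1≢1
      ; (suc (suc k)) _ _ → *-zeroˡ (a (n ∸ suc k)) })
  (*-identityˡ (a n))

⊛-shift : ∀ a b n → (a ⊛ shift b) n ≡ shift (a ⊛ b) n
⊛-shift a b zero    = trans (+-identityˡ _) (*-zeroʳ (a 0))
⊛-shift a b (suc n) = begin
  ∑[ k ≤ n ] (a k * shift b (suc n ∸ k)) + a (suc n) * shift b (n ∸ n)
    ≡⟨ cong₂ _+_ (∑-cong (suc n) λ k k≤n → cong (λ m → a k * shift b m) (ℕₚ.+-∸-assoc 1 (ℕ.s≤s⁻¹ k≤n)))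
                 (*-zeroʳ′ (a (suc n)) (cong (shift b) (ℕₚ.n∸n≡0 n))) ⟩
  (a ⊛ b) n + 0ℚ
    ≡⟨ +-identityʳ _ ⟩
  (a ⊛ b) n
    ∎

⊛-⊕ : ∀ a b c n → (a ⊛ (b ⊕ c)) n ≡ ((a ⊛ b) ⊕ (a ⊛ c)) n
⊛-⊕ a b c n = trans (∑-cong (suc n) (λ k _ → *-distribˡ-+ (a k) (b (n ∸ k)) (c (n ∸ k))))
  (∑-+ (suc n) _ _)

⊛-congʳ : ∀ a {b c} → (∀ n → b n ≡ c n) → ∀ n → (a ⊛ b) n ≡ (a ⊛ c) n
⊛-congʳ a b≗c n = ∑-cong (suc n) (λ k _ → cong (a k *_) (b≗c (n ∸ k)))

⊛-one : ∀ a n → (a ⊛ one) n ≡ a n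
⊛-one a n = trans
  (cong₂ _+_ (∑-zero n λ k k<n → *-zeroʳ′ (a k) (one-positive (ℕₚ.m<n⇒0<n∸m k<n)))
             (cong (λ m → a n * one m) (ℕₚ.n∸n≡0 n)))
  (trans (+-identityˡ _) (*-identityʳ (a n)))
  where
  one-positive : ∀ {m} → 0 < m → one m ≡ 0ℚ
  one-positive (s≤s _) = refl

x+x²-⊛ : ∀ a n → (x+x² ⊛ a) n ≡ (shift a ⊕ shift (shift a)) n
x+x²-⊛ a zero    = trans (+-identityˡ _) (*-zeroˡ (a 0))
x+x²-⊛ a (suc n) = begin
  ∑[ k ≤ suc n ] (x+x² k * a (suc n ∸ k))
    ≡⟨ ∑-cong (suc (suc n)) (λ k _ → cong (_* a (suc n ∸ k)) (X-⊛ (one ⊕ X) k)) ⟩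
  ∑[ k ≤ suc n ] (shift (one ⊕ X) k * a (suc n ∸ k))
    ≡⟨ ∑-suc (suc n) _ ⟩
  0ℚ * a (suc n) + ∑[ k ≤ n ] ((one ⊕ X) k * a (n ∸ k))
    ≡⟨ cong₂ _+_ (*-zeroˡ (a (suc n))) (∑-suc n _) ⟩
  0ℚ + (1ℚ * a n + ∑[ k < n ] ((one ⊕ X) (suc k) * a (n ∸ suc k)))
    ≡⟨ trans (+-identityˡ _) (cong (_+ ∑[ k < n ] ((one ⊕ X) (suc k) * a (n ∸ suc k))) (*-identityˡ (a n))) ⟩
  a n + ∑[ k < n ] ((one ⊕ X) (suc k) * a (n ∸ suc k))
    ≡⟨ cong (_+_ (a n)) (linear n) ⟩
  a n + shift a n
    ∎
  where
  linear : ∀ n → ∑[ k < n ] ((one ⊕ X) (suc k) * a (n ∸ suc k)) ≡ shift a n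
  linear zero    = refl
  linear (suc n) = trans
    (∑-single (suc n) (s≤s z≤n)
      λ { zero _ 0≢0 → contradiction refl 0≢0
        ; (suc k) _ _ → *-zeroˡ (a (n ∸ suc k)) })
    (*-identityˡ (a n))

-- Products of a triangular matrix with (g, x(1+x)).

module _ (g : Series) (pair : IsRiordanPair g x+x²) where

  private
    A : Triangular
    A = riordan g x+x² pair

    column : ℕ → Series
    column j n = entry A n j

  -- The extra factor x(1+x) of the next power can be pulled out past `g`, because shifts commute
  -- with multiplication by `g`.
  column-suc : ∀ j n → column (suc j) n ≡ (shift (column j) ⊕ shift (shift (column j))) n
  column-suc j n = begin
    (g ⊛ (x+x² ⊛ p)) n                            ≡⟨ ⊛-congʳ g (x+x²-⊛ p) n ⟩
    (g ⊛ (shift p ⊕ shift (shift p))) n           ≡⟨ ⊛-⊕ g (shift p) (shift (shift p)) n ⟩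
    (g ⊛ shift p) n + (g ⊛ shift (shift p)) n     ≡⟨ cong₂ _+_ (⊛-shift g p n)
      (trans (⊛-shift g (shift p) n) (shift-cong (⊛-shift g p) n)) ⟩
    shift (g ⊛ p) n + shift (shift (g ⊛ p)) n     ∎
    where
    p : Series
    p = x+x² ⋆ j

  module _ (T : Triangular)
           (T-rec : ∀ n j → entry T (suc n) (suc j) + entry T (suc n) (suc (suc j)) ≡ entry T n j) where

    -- Summation by parts: `column-suc` writes the next column as two shifts of column `j`. Moved
    -- over to row `n+1` of `T`, they pair the entries `k+1` and `k+2`, which `T-rec` merges into
    -- `entry T n k`.
    ⊡-riordan-diagonal : ∀ n j → entry (T ⊡ A) (suc n) (suc j) ≡ entry (T ⊡ A) n j
    ⊡-riordan-diagonal n j = begin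
      ∑[ k ≤ suc n ] (t k * column (suc j) k)
        ≡⟨ ∑-cong (suc (suc n)) (λ k _ → trans (cong (t k *_) (column-suc j k))
             (*-distribˡ-+ (t k) (shift u k) (shift (shift u) k))) ⟩
      ∑[ k ≤ suc n ] (t k * shift u k + t k * shift (shift u) k)
        ≡⟨ ∑-+ (suc (suc n)) _ _ ⟩
      ∑[ k ≤ suc n ] (t k * shift u k) + ∑[ k ≤ suc n ] (t k * shift (shift u) k)
        ≡⟨ cong₂ _+_ (unshift t u (suc n)) (trans (unshift t (shift u) (suc n)) (unshift (λ k → t (suc k)) u n)) ⟩
      ∑[ k ≤ n ] (t (suc k) * u k) + ∑[ k < n ] (t (suc (suc k)) * u k)
        -- The index `n` may be added to the second sum: `t (n+2)` lies above the diagonal in row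
        -- `n+1`.
        ≡⟨ cong (_+_ (∑[ k ≤ n ] (t (suc k) * u k))) (∑-extend (ℕₚ.n≤1+n n) λ k n≤k _ →
             *-zeroˡ′ (u k) (upper T (s≤s (s≤s n≤k)))) ⟨
      ∑[ k ≤ n ] (t (suc k) * u k) + ∑[ k ≤ n ] (t (suc (suc k)) * u k)
        ≡⟨ ∑-+ (suc n) _ _ ⟨
      ∑[ k ≤ n ] (t (suc k) * u k + t (suc (suc k)) * u k)
        ≡⟨ ∑-cong (suc n) (λ k _ → trans (sym (*-distribʳ-+ (u k) (t (suc k)) (t (suc (suc k)))))
             (cong (_* u k) (T-rec n k))) ⟩
      ∑[ k ≤ n ] (entry T n k * u k)
        ∎
      where
      t u : Series
      t = entry T (suc n)
      u = column j
      unshift : ∀ (s v : Series) m → ∑[ k ≤ m ] (s k * shift v k) ≡ ∑[ k < m ] (s (suc k) * v k)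
      unshift s v m = trans (∑-suc m (λ k → s k * shift v k))
        (trans (cong (_+ ∑[ k < m ] (s (suc k) * v k)) (*-zeroʳ (s 0))) (+-identityˡ _))

    -- Column 0 of `A` is `g`, so the hypothesis says that `T ⊡ A` agrees with `I` in column 0. Row
    -- 0 agrees by triangularity, and every other entry moves along its diagonal to one of these.
    ⊡-riordan-identity : (∀ n → ∑[ k ≤ n ] (entry T n k * g k) ≡ one n) → T ⊡ A ≋ I
    ⊡-riordan-identity column₀ n zero = trans
      (∑-cong (suc n) (λ k _ → cong (entry T n k *_) (⊛-one g k)))
      (trans (column₀ n) (one-I n))
      where
      one-I : ∀ n → one n ≡ entry I n 0
      one-I zero    = refl
      one-I (suc n) = refl
    ⊡-riordan-identity column₀ zero (suc j) = upper (T ⊡ A) {zero} {suc j} (s≤s z≤n)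
    ⊡-riordan-identity column₀ (suc n) (suc j) = trans (⊡-riordan-diagonal n j)
      (trans (⊡-riordan-identity column₀ n j) I-diagonal)
      where
      I-diagonal : entry I n j ≡ entry I (suc n) (suc j)
      I-diagonal with n ℕ.≟ j
      ... | yes refl = sym (diagonal-≡ (λ _ → 1ℚ) (λ _ → 1≢0) (suc n))
      ... | no  n≢j  = sym (diagonal-≢ (λ _ → 1ℚ) (λ _ → 1≢0) λ eq → n≢j (ℕₚ.suc-injective eq))

-- Conjugation by `D`.

sign : ℕ → ℚ
sign n = (- 1ℚ) ^ n

sign-square : ∀ n → sign n * sign n ≡ 1ℚ
sign-square zero    = refl
sign-square (suc n) = trans
  (solve 1 (λ s → (:- con 1ℚ :* s) :* (:- con 1ℚ :* s) := s :* s) refl (sign n))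
  (sign-square n)
  where open +-*-Solver

D-conjugate : ∀ A n j → entry (D ⊡ A ⊡ D) n j ≡ sign n * entry A n j * sign j
D-conjugate A n j with j ℕ.≤? n
... | yes j≤n = begin
  ∑[ k ≤ n ] (entry (D ⊡ A) n k * entry D k j)
    ≡⟨ ∑-single (suc n) (s≤s j≤n) (λ k _ k≢j →
         *-zeroʳ′ (entry (D ⊡ A) n k) (diagonal-≢ sign (^-≢0 (λ ())) k≢j)) ⟩
  entry (D ⊡ A) n j * entry D j j
    ≡⟨ cong₂ _*_ (∑-single (suc n) (ℕₚ.n<1+n n) λ k _ k≢n →
         *-zeroˡ′ (entry A k j) (diagonal-≢ sign (^-≢0 (λ ())) (λ n≡k → k≢n (sym n≡k))))
         (diagonal-≡ sign (^-≢0 (λ ())) j) ⟩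
  entry D n n * entry A n j * sign j
    ≡⟨ cong (λ s → s * entry A n j * sign j) (diagonal-≡ sign (^-≢0 (λ ())) n) ⟩
  sign n * entry A n j * sign j
    ∎
... | no j≰n = trans (upper (D ⊡ A ⊡ D) (ℕₚ.≰⇒> j≰n))
  (sym (*-zeroˡ′ (sign j) (*-zeroʳ′ (sign n) (upper A (ℕₚ.≰⇒> j≰n)))))

D-involutive : ∀ A n j → sign n * entry (D ⊡ A ⊡ D) n j * sign j ≡ entry A n j
D-involutive A n j = begin
  sign n * entry (D ⊡ A ⊡ D) n j * sign j
    ≡⟨ cong (λ e → sign n * e * sign j) (D-conjugate A n j) ⟩
  sign n * (sign n * entry A n j * sign j) * sign j
    ≡⟨ solve 3 (λ s a t → s :* (s :* a :* t) :* t := (s :* s) :* a :* (t :* t)) refl (sign n) (entry A n j) (sign j) ⟩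
  (sign n * sign n) * entry A n j * (sign j * sign j)
    ≡⟨ cong₂ (λ s t → s * entry A n j * t) (sign-square n) (sign-square j) ⟩
  1ℚ * entry A n j * 1ℚ
    ≡⟨ trans (*-identityʳ _) (*-identityˡ _) ⟩
  entry A n j
    ∎
  where open +-*-Solver

-- For f = xC(x) we have f = f² + x; this is the coefficient of x^(n+1) in g f^(j+1) = g f^(j+2) + x
-- g f^j.
Recurrent : (ℕ → ℕ → ℚ) → Set
Recurrent M = ∀ n j → M (suc n) (suc j) ≡ M (suc n) (suc (suc j)) + M n j

-- `D ⊡ M ⊡ D` is a left inverse of the Riordan matrix, hence equal to its inverse; conjugating once
-- more gives back `M` because D² = I.
D-conjugate-inverse : ∀ g (pair : IsRiordanPair g x+x²) (M : Triangular) → Recurrent (entry M) →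
  (∀ n → ∑[ k ≤ n ] (entry (D ⊡ M ⊡ D) n k * g k) ≡ one n) →
  ∀ n j → entry (D ⊡ riordan g x+x² pair ⁻¹ ⊡ D) n j ≡ entry M n j
D-conjugate-inverse g pair M M-rec column₀ n j = begin
  entry (D ⊡ A ⁻¹ ⊡ D) n j                ≡⟨ D-conjugate (A ⁻¹) n j ⟩
  sign n * entry (A ⁻¹) n j * sign j      ≡⟨ cong (λ e → sign n * e * sign j) (T≋A⁻¹ n j) ⟨
  sign n * entry T n j * sign j           ≡⟨ D-involutive M n j ⟩
  entry M n j                             ∎
  where
  A T : Triangular
  A = riordan g x+x² pair
  T = D ⊡ M ⊡ D

  T-rec : ∀ n j → entry T (suc n) (suc j) + entry T (suc n) (suc (suc j)) ≡ entry T n j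
  T-rec n j = begin
    entry T (suc n) (suc j) + entry T (suc n) (suc (suc j))
      ≡⟨ cong₂ _+_ (trans (D-conjugate M (suc n) (suc j)) (cong (λ e → sign (suc n) * e * sign (suc j)) (M-rec n j)))
                   (D-conjugate M (suc n) (suc (suc j))) ⟩
    sign (suc n) * (b + c) * sign (suc j) + sign (suc n) * b * sign (suc (suc j))
      -- The second product carries one factor -1 more than the first, so the terms in `b` cancel.
      ≡⟨ solve 4 (λ s t b c → (:- con 1ℚ :* s) :* (b :+ c) :* (:- con 1ℚ :* t)
                     :+ (:- con 1ℚ :* s) :* b :* (:- con 1ℚ :* (:- con 1ℚ :* t)) := s :* c :* t)
           refl (sign n) (sign j) b c ⟩
    sign n * c * sign j
      ≡⟨ D-conjugate M n j ⟨
    entry T n j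
      ∎
    where
    open +-*-Solver
    b c : ℚ
    b = entry M (suc n) (suc (suc j))
    c = entry M n j

  T≋A⁻¹ : T ≋ A ⁻¹
  T≋A⁻¹ = left≋right {A} {T} {A ⁻¹} (⊡-riordan-identity g pair T T-rec column₀) (⊡-inverseʳ A)

-- The binomials binom(2n-j, n).

-- Row 0 is separate because binom(2n-j, n) with truncated subtraction would be 1 for every j there.
central : ℕ → ℕ → ℕ
central zero    zero    = 1
central zero    (suc j) = 0
central (suc n) j       = (2 ℕ.* suc n ∸ j) C suc n

central-≡ : ∀ n {j} → j ≤ 2 ℕ.* n → central n j ≡ (2 ℕ.* n ∸ j) C n
central-≡ zero    z≤n = refl
central-≡ (suc n) _   = refl

2[1+n]∸[2+n]≡n : ∀ n → 2 ℕ.* suc n ∸ suc (suc n) ≡ n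
2[1+n]∸[2+n]≡n n = trans (cong (_∸ suc n) (ℕₚ.+-suc n (n ℕ.+ 0)))
  (trans (ℕₚ.m+n∸m≡n n (n ℕ.+ 0)) (ℕₚ.+-identityʳ n))

central-upper : ∀ {n j} → n < j → central n j ≡ 0
central-upper {zero}  {suc j} _   = refl
central-upper {suc n} {j}     n<j = k>n⇒nCk≡0 (s≤s
  (ℕₚ.≤-trans (ℕₚ.∸-monoʳ-≤ (2 ℕ.* suc n) n<j) (ℕₚ.≤-reflexive (2[1+n]∸[2+n]≡n n))))

central-diagonal : ∀ n → central n n ≡ 1
central-diagonal zero    = refl
central-diagonal (suc n) = trans
  (cong (_C suc n) (trans (ℕₚ.m+n∸m≡n n (suc n ℕ.+ 0)) (ℕₚ.+-identityʳ (suc n))))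
  (nCn≡1 (suc n))

-- For j ≤ 2n this is Pascal's rule with upper index 2n-j. For larger j also n < j, and all three
-- entries are 0.
central-rec : ∀ n j → central (suc n) (suc j) ≡ central (suc n) (suc (suc j)) ℕ.+ central n j
central-rec n j with j ℕ.≤? 2 ℕ.* n
... | yes j≤2n rewrite ℕₚ.+-suc n (n ℕ.+ 0) = trans (pascal-∸ n j≤2n)
  (cong ((2 ℕ.* n ∸ j) C suc n ℕ.+_) (sym (central-≡ n j≤2n)))
... | no j≰2n = trans (central-upper {suc n} {suc j} (s≤s n<j))
  (sym (cong₂ ℕ._+_ (central-upper {suc n} {suc (suc j)} (s≤s (ℕₚ.m<n⇒m<1+n n<j))) (central-upper n<j)))
  where
  n<j : n < j
  n<j = ℕₚ.≤-<-trans (ℕₚ.m≤m+n n (n ℕ.+ 0)) (ℕₚ.≰⇒> j≰2n)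

-- Pascal's rule and the symmetry binom(2n+1, n) = binom(2n+1, n+1). This is what makes column 0
-- right for both inverses.
central-column₀ : ∀ n → central (suc n) 0 ≡ central (suc n) 1 ℕ.+ central (suc n) 1
central-column₀ n = begin
  suc N C suc n          ≡⟨ nCk+nC[k+1]≡[n+1]C[k+1] N n ⟨
  N C n ℕ.+ N C suc n    ≡⟨ cong (ℕ._+ N C suc n)
    (trans (cong (N C_) (sym (2[1+n]∸[2+n]≡n n))) (sym (nCk≡nC[n∸k] 1+n≤N))) ⟩
  N C suc n ℕ.+ N C suc n ∎
  where
  N : ℕ
  N = n ℕ.+ suc (n ℕ.+ 0)
  1+n≤N : suc n ≤ N
  1+n≤N = subst (suc n ≤_) (sym (ℕₚ.+-suc n (n ℕ.+ 0))) (s≤s (ℕₚ.m≤m+n n (n ℕ.+ 0)))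

central-column₀-catalan : ∀ n → fromℕ (central n 0) ≡ fromℕ (n ℕ.+ 1) * catalan n
central-column₀-catalan n = fromℕ-*-/ {central n 0} {n ℕ.+ 1} n (begin
  central n 0 ℕ.* suc n                 ≡⟨ cong (ℕ._* suc n) (central-≡ n z≤n) ⟩
  ((2 ℕ.* n) C n) ℕ.* suc n             ≡⟨ ℕₚ.*-comm ((2 ℕ.* n) C n) (suc n) ⟩
  suc n ℕ.* ((2 ℕ.* n) C n)             ≡⟨ cong (ℕ._* ((2 ℕ.* n) C n)) (ℕₚ.+-comm 1 n) ⟩
  (n ℕ.+ 1) ℕ.* ((2 ℕ.* n) C n)         ∎)

central-column₁-catalan : ∀ n → fromℕ (central (suc n) 1) ≡ fromℕ (2 ℕ.* suc n ∸ 1) * catalan n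
central-column₁-catalan n = fromℕ-*-/ {N C suc n} {N} n (begin
  (N C suc n) ℕ.* suc n             ≡⟨ ℕₚ.*-comm (N C suc n) (suc n) ⟩
  suc n ℕ.* (N C suc n)             ≡⟨ cong (λ m → suc n ℕ.* (m C suc n)) N≡1+2n ⟩
  suc n ℕ.* (suc (2 ℕ.* n) C suc n) ≡⟨ absorption (2 ℕ.* n) n ⟩
  suc (2 ℕ.* n) ℕ.* ((2 ℕ.* n) C n) ≡⟨ cong (ℕ._* ((2 ℕ.* n) C n)) N≡1+2n ⟨
  N ℕ.* ((2 ℕ.* n) C n)             ∎)
  where
  N : ℕ
  N = n ℕ.+ suc (n ℕ.+ 0)
  N≡1+2n : N ≡ suc (2 ℕ.* n)
  N≡1+2n = ℕₚ.+-suc n (n ℕ.+ 0)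

-- The candidate matrices `Q` and `R` and their first columns.

Q : Triangular
Q = record
  { entry  = λ n j → fromℕ (central n j)
  ; upper  = λ {n} {j} n<j → cong fromℕ (central-upper {n} {j} n<j)
  ; diag≢0 = λ n → subst (λ m → fromℕ m ≢ 0ℚ) (sym (central-diagonal n)) 1≢0
  }

Q-rec : Recurrent (entry Q)
Q-rec n j = trans (cong fromℕ (central-rec n j)) (fromℕ-+ (central (suc n) (suc (suc j))) (central n j))

Q-column₀ : ∀ n → entry Q (suc n) 0 ≡ entry Q (suc n) 1 + entry Q (suc n) 1
Q-column₀ n = trans (cong fromℕ (central-column₀ n)) (fromℕ-+ (central (suc n) 1) (central (suc n) 1))

-- Expanding the factor 2n+1 over `fromℕ n` removes truncated subtraction, so that the ring solver
-- can derive the later columns.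
Q-column₁ : ∀ n → entry Q (suc n) 1 ≡ (1ℚ + (fromℕ n + fromℕ n)) * catalan n
Q-column₁ n = trans (central-column₁-catalan n) (cong (_* catalan n) (begin
  fromℕ (n ℕ.+ suc (n ℕ.+ 0))        ≡⟨ cong fromℕ (trans (ℕₚ.+-suc n (n ℕ.+ 0))
                                          (cong (λ m → suc (n ℕ.+ m)) (ℕₚ.+-identityʳ n))) ⟩
  fromℕ (1 ℕ.+ (n ℕ.+ n))            ≡⟨ fromℕ-+ 1 (n ℕ.+ n) ⟩
  1ℚ + fromℕ (n ℕ.+ n)               ≡⟨ cong (_+_ 1ℚ) (fromℕ-+ n n) ⟩
  1ℚ + (fromℕ n + fromℕ n)           ∎))

summand : ∀ {a b c} → a ≡ b + c → b ≡ a + - c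
summand {b = b} {c} refl = solve 2 (λ b c → b := (b :+ c) :+ :- c) refl b c
  where open +-*-Solver

Q-column₂ : ∀ n → entry Q (suc n) 2 ≡ fromℕ n * catalan n
Q-column₂ n = begin
  entry Q (suc n) 2
    ≡⟨ summand (Q-rec n 0) ⟩
  entry Q (suc n) 1 + - entry Q n 0
    ≡⟨ cong₂ (λ x y → x + - y) (Q-column₁ n)
         (trans (central-column₀-catalan n) (cong (_* catalan n) (fromℕ-+ n 1))) ⟩
  (1ℚ + (fromℕ n + fromℕ n)) * catalan n + - ((fromℕ n + 1ℚ) * catalan n)
    ≡⟨ solve 2 (λ m c → (con 1ℚ :+ (m :+ m)) :* c :+ :- ((m :+ con 1ℚ) :* c) := m :* c) refl (fromℕ n) (catalan n) ⟩
  fromℕ n * catalan n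
    ∎
  where open +-*-Solver

Q-column₃ : ∀ n → entry Q (suc (suc n)) 3 ≡
  fromℕ (suc n) * catalan (suc n) + - ((1ℚ + (fromℕ n + fromℕ n)) * catalan n)
Q-column₃ n = trans (summand (Q-rec (suc n) 1))
  (cong₂ (λ x y → x + - y) (Q-column₂ (suc n)) (Q-column₁ n))

-- Since 1 - 2xC(x) = √(1-4x), subtracting twice the next column turns (1/√(1-4x), xC) into (1, xC).
R : Triangular
R = record
  { entry  = e
  ; upper  = λ {n} {j} n<j → cong₂ (λ x y → x + - (y + y)) (upper Q {n} {j} n<j)
      (upper Q {n} {suc j} (ℕₚ.m<n⇒m<1+n n<j))
  ; diag≢0 = λ n → subst (_≢ 0ℚ) (sym (cong₂ (λ x y → x + - (y + y)) (cong fromℕ (central-diagonal n))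
      (upper Q {n} {suc n} (ℕₚ.n<1+n n)))) (λ ())
  }
  where
  e : ℕ → ℕ → ℚ
  e n j = entry Q n j + - (entry Q n (suc j) + entry Q n (suc j))

R-rec : Recurrent (entry R)
R-rec n j = trans
  (cong₂ (λ x y → x + - (y + y)) (Q-rec n j) (Q-rec n (suc j)))
  (solve 4 (λ a b c d → (a :+ b) :+ :- ((c :+ d) :+ (c :+ d)) := (a :+ :- (c :+ c)) :+ (b :+ :- (d :+ d))) refl
    (entry Q (suc n) (suc (suc j))) (entry Q n j) (entry Q (suc n) (suc (suc (suc j)))) (entry Q n (suc j)))
  where open +-*-Solver

R-column₀ : ∀ n → entry R n 0 ≡ one n
R-column₀ zero    = refl
R-column₀ (suc n) = trans (cong (_+ - (y + y)) (Q-column₀ n)) (+-inverseʳ (y + y))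
  where
  y : ℚ
  y = entry Q (suc n) 1

R-column₁ : ∀ n → entry R (suc n) 1 ≡ catalan n
R-column₁ n = trans (cong₂ (λ x y → x + - (y + y)) (Q-column₁ n) (Q-column₂ n))
  (solve 2 (λ m c → (con 1ℚ :+ (m :+ m)) :* c :+ :- (m :* c :+ m :* c) := c) refl (fromℕ n) (catalan n))
  where open +-*-Solver

-- The recurrence subtracts an entry of column 0 from column 1. That entry is 0 except in row 0,
-- which is why the rows start at 2.
R-column₂ : ∀ n → entry R (suc (suc n)) 2 ≡ catalan (suc n)
R-column₂ n = trans (summand (R-rec (suc n) 0))
  (trans (cong₂ (λ x y → x + - y) (R-column₁ (suc n)) (R-column₀ (suc n))) (+-identityʳ _))

-- Identification of the conjugated inverses with `R` and `Q`.

𝔽ˢ-entries : ∀ n j → entry (D ⊡ 𝔽ˢ ⁻¹ ⊡ D) n j ≡ entry R n j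
𝔽ˢ-entries = D-conjugate-inverse one _ R R-rec λ n → begin
  ∑[ k ≤ n ] (entry (D ⊡ R ⊡ D) n k * one k)
    ≡⟨ ∑-single (suc n) (s≤s z≤n) (λ { zero _ 0≢0 → contradiction refl 0≢0
                                     ; (suc k) _ _ → *-zeroʳ (entry (D ⊡ R ⊡ D) n (suc k)) }) ⟩
  entry (D ⊡ R ⊡ D) n 0 * 1ℚ
    ≡⟨ trans (*-identityʳ _) (trans (D-conjugate R n 0) (*-identityʳ _)) ⟩
  sign n * entry R n 0
    ≡⟨ cong (sign n *_) (R-column₀ n) ⟩
  sign n * one n
    ≡⟨ sign-one n ⟩
  one n
    ∎
  where
  sign-one : ∀ n → sign n * one n ≡ one n
  sign-one zero    = refl
  sign-one (suc n) = *-zeroʳ (sign (suc n))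

-- With g = 1+2x only columns 0 and 1 of `D ⊡ Q ⊡ D` enter. They have opposite signs, and below row
-- 0 column 0 of `Q` is twice column 1, so they cancel.
𝕃ˢ-entries : ∀ n j → entry (D ⊡ 𝕃ˢ ⁻¹ ⊡ D) n j ≡ entry Q n j
𝕃ˢ-entries = D-conjugate-inverse g _ Q Q-rec column₀
  where
  open +-*-Solver
  g : Series
  g = one ⊕ (+ 2 / 1) · X
  column₀ : ∀ n → ∑[ k ≤ n ] (entry (D ⊡ Q ⊡ D) n k * g k) ≡ one n
  column₀ zero    = refl
  column₀ (suc n) = begin
    ∑[ k ≤ suc n ] (t k * g k)
      ≡⟨ ∑-extend {2} {suc (suc n)} (s≤s (s≤s z≤n)) {λ k → t k * g k}
           (λ { (suc zero) (s≤s ()) _ ; (suc (suc k)) _ _ → *-zeroʳ (t (suc (suc k))) }) ⟩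
    0ℚ + t 0 * 1ℚ + t 1 * (+ 2 / 1)
      ≡⟨ cong₂ (λ x y → 0ℚ + x * 1ℚ + y * (+ 2 / 1)) (D-conjugate Q (suc n) 0) (D-conjugate Q (suc n) 1) ⟩
    0ℚ + (s * entry Q (suc n) 0 * 1ℚ) * 1ℚ + (s * q * sign 1) * (+ 2 / 1)
      ≡⟨ cong (λ x → 0ℚ + (s * x * 1ℚ) * 1ℚ + (s * q * sign 1) * (+ 2 / 1)) (Q-column₀ n) ⟩
    0ℚ + (s * (q + q) * 1ℚ) * 1ℚ + (s * q * sign 1) * (+ 2 / 1)
      ≡⟨ solve 2 (λ s q → con 0ℚ :+ (s :* (q :+ q) :* con 1ℚ) :* con 1ℚ :+ (s :* q :* con (sign 1)) :* con (+ 2 / 1)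
                    := con 0ℚ) refl s q ⟩
    0ℚ
      ∎
    where
    t : Series
    t = entry (D ⊡ Q ⊡ D) (suc n)
    s q : ℚ
    s = sign (suc n)
    q = entry Q (suc n) 1

-- Alternating Catalan sums and their recurrence.

-- Here j counts from the first column to which the formula applies, h j is the last index of
-- summation, and w j k i is the coefficient of ± catalan i.
module CatalanSum
  (h : ℕ → ℕ) (w : ℕ → ℕ → ℕ → ℕ)
  (h-suc-suc : ∀ j → h (suc (suc j)) ≡ suc (h j))
  (h-suc : ∀ j → h (suc j) ≤ suc (h j))
  (w-zero : ∀ j i → w (suc (suc j)) 0 i ≡ w (suc j) 0 i)
  (w-suc : ∀ j k i → k ≤ h j → w (suc (suc j)) (suc k) i ≡ w (suc j) (suc k) i ℕ.+ w j k i)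
  (w-vanish : ∀ j k i → h (suc j) < k → w (suc j) k i ≡ 0)
  where

  term : ℕ → ℕ → ℕ → ℚ
  term n j k = (- 1ℚ) ^ k * fromℕ (w j k (n ∸ 1 ∸ k)) * catalan (n ∸ 1 ∸ k)

  catalanSum : ℕ → ℕ → ℚ
  catalanSum n j = ∑[ k ≤ h j ] term n j k

  -- Lowering `n` by one lowers the Catalan index by one, so summand `k` of column `j` meets summand
  -- `k+1` of the two later columns, with opposite sign; `w-suc` then gives the recurrence termwise.
  -- The summand at index 0 is settled by `w-zero`.
  catalanSum-rec : ∀ n j → catalanSum (suc n) (suc j) ≡ catalanSum (suc n) (suc (suc j)) + catalanSum n j
  catalanSum-rec n j = begin
    ∑[ k ≤ h (suc j) ] term (suc n) (suc j) k
      -- `h (suc j)` can be smaller than `suc (h j)`; the sum is padded with zero terms to a common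
      -- range.
      ≡⟨ ∑-extend (s≤s (h-suc j)) (λ k h<k _ → *-zeroˡ′ (catalan (n ∸ k))
           (*-zeroʳ′ (sign k) (cong fromℕ (w-vanish j k (n ∸ k) h<k)))) ⟨
    ∑[ k ≤ suc (h j) ] term (suc n) (suc j) k
      ≡⟨ ∑-suc (suc (h j)) _ ⟩
    term (suc n) (suc j) 0 + ∑[ k ≤ h j ] term (suc n) (suc j) (suc k)
      ≡⟨ cong₂ _+_ (cong (λ m → 1ℚ * fromℕ m * catalan n) (sym (w-zero j n)))
           (trans (∑-cong (suc (h j)) (λ k k≤h → term-rec k (ℕ.s≤s⁻¹ k≤h))) (∑-+ (suc (h j)) _ _)) ⟩
    term (suc n) (suc (suc j)) 0 + (∑[ k ≤ h j ] term (suc n) (suc (suc j)) (suc k) + catalanSum n j)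
      ≡⟨ +-assoc (term (suc n) (suc (suc j)) 0) _ _ ⟨
    term (suc n) (suc (suc j)) 0 + ∑[ k ≤ h j ] term (suc n) (suc (suc j)) (suc k) + catalanSum n j
      ≡⟨ cong (_+ catalanSum n j) (∑-suc (suc (h j)) _) ⟨
    ∑[ k ≤ suc (h j) ] term (suc n) (suc (suc j)) k + catalanSum n j
      ≡⟨ cong (λ m → ∑[ k ≤ m ] term (suc n) (suc (suc j)) k + catalanSum n j) (h-suc-suc j) ⟨
    catalanSum (suc n) (suc (suc j)) + catalanSum n j
      ∎
    where
    term-rec : ∀ k → k ≤ h j → term (suc n) (suc j) (suc k) ≡ term (suc n) (suc (suc j)) (suc k) + term n j k
    term-rec k k≤h = begin
      sign (suc k) * x * c
        ≡⟨ solve 4 (λ s x y c → (:- con 1ℚ :* s) :* x :* c := (:- con 1ℚ :* s) :* (x :+ y) :* c :+ s :* y :* c) refl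
             (sign k) x y c ⟩
      sign (suc k) * (x + y) * c + sign k * y * c
        ≡⟨ cong₂ _+_ (cong (λ z → sign (suc k) * z * c)
             (trans (sym (fromℕ-+ (w (suc j) (suc k) i) (w j k i))) (cong fromℕ (sym (w-suc j k i k≤h)))))
             (cong (λ m → sign k * fromℕ (w j k m) * catalan m) i≡) ⟩
      term (suc n) (suc (suc j)) (suc k) + term n j k
        ∎
      where
      open +-*-Solver
      i : ℕ
      i = n ∸ suc k
      i≡ : i ≡ n ∸ 1 ∸ k
      i≡ = sym (ℕₚ.∸-+-assoc n 1 k)
      x y c : ℚ
      x = fromℕ (w (suc j) (suc k) i)
      y = fromℕ (w j k i)
      c = catalan i

  -- The recurrence gives column `j+2` from column `j+1` in the same row and column `j` in the row
  -- above. With `d` the true number of the first column, `d + j ≤ n` keeps the entries on or below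
  -- the diagonal, where the formula is valid.
  catalanSum-unique : ∀ (M : ℕ → ℕ → ℚ) d → Recurrent M →
    (∀ n → d ≤ n → M n 0 ≡ catalanSum n 0) →
    (∀ n → suc d ≤ n → M n 1 ≡ catalanSum n 1) →
    ∀ n j → d ℕ.+ j ≤ n → M n j ≡ catalanSum n j
  catalanSum-unique M d M-rec base₀ base₁ n j d+j≤n =
    -- In the order `j + d` the bound reduces on the constructors of `j`, so `s≤s` can be matched.
    go n j (subst (_≤ n) (ℕₚ.+-comm d j) d+j≤n)
    where
    open GroupProperties +-0-group using (∙-cancelʳ)
    go : ∀ n j → j ℕ.+ d ≤ n → M n j ≡ catalanSum n j
    go n       zero          le       = base₀ n le
    go n       (suc zero)    le       = base₁ n le
    go (suc n) (suc (suc j)) (s≤s le) = ∙-cancelʳ (M n j) _ _ (begin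
      M (suc n) (suc (suc j)) + M n j                   ≡⟨ M-rec n j ⟨
      M (suc n) (suc j)                                 ≡⟨ go (suc n) (suc j) (ℕₚ.m≤n⇒m≤1+n le) ⟩
      catalanSum (suc n) (suc j)                        ≡⟨ catalanSum-rec n j ⟩
      catalanSum (suc n) (suc (suc j)) + catalanSum n j ≡⟨ cong (_+_ (catalanSum (suc n) (suc (suc j))))
                                                              (go n j (ℕₚ.<⇒≤ le)) ⟨
      catalanSum (suc n) (suc (suc j)) + M n j          ∎)

-- The Catalan sums for the columns of `R` and `Q`.

1+n∸k≤1+[n∸k] : ∀ n k → suc n ∸ k ≤ suc (n ∸ k)
1+n∸k≤1+[n∸k] n       zero    = ℕₚ.≤-refl
1+n∸k≤1+[n∸k] zero    (suc k) = ℕₚ.≤-trans (ℕₚ.≤-reflexive (ℕₚ.0∸n≡0 k)) z≤n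
1+n∸k≤1+[n∸k] (suc n) (suc k) = 1+n∸k≤1+[n∸k] n k

-- Induction lowering `n` by 2 and `k` by 1. It makes binom(n-k, k) vanish past half of `n`, as the
-- padding of the sums requires.
⌊n/2⌋<k⇒n∸k<k : ∀ n {k} → ⌊ n /2⌋ < k → n ∸ k < k
⌊n/2⌋<k⇒n∸k<k zero          {suc k} _        = s≤s z≤n
⌊n/2⌋<k⇒n∸k<k (suc zero)    {suc k} _        = s≤s (ℕₚ.≤-trans (ℕₚ.m∸n≤m 0 k) z≤n)
⌊n/2⌋<k⇒n∸k<k (suc (suc n)) {suc k} (s≤s lt) =
  s≤s (ℕₚ.≤-trans (1+n∸k≤1+[n∸k] n k) (⌊n/2⌋<k⇒n∸k<k n lt))

[n∸k]Ck-vanish : ∀ n {k} → ⌊ n /2⌋ < k → (n ∸ k) C k ≡ 0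
[n∸k]Ck-vanish n lt = k>n⇒nCk≡0 (⌊n/2⌋<k⇒n∸k<k n lt)

-- The weights binom(j-k, k) obey Pascal's rule. In the two base columns, 1 and 2 of `R`, the sum
-- has a single term of weight 1.
R-columns : ∀ n j → suc j ≤ n → entry R n (suc j) ≡ ∑[ k ≤ ⌊ j /2⌋ ]
  ((- 1ℚ) ^ k * fromℕ ((j ∸ k) C k) * catalan (n ∸ 1 ∸ k))
R-columns = catalanSum-unique (λ n j → entry R n (suc j)) 1 (λ n j → R-rec n (suc j))
  (λ { (suc n) _ → trans (R-column₁ n) (sym (unit (catalan n))) })
  (λ { (suc zero) (s≤s ()) ; (suc (suc n)) _ → trans (R-column₂ n) (sym (unit (catalan (suc n)))) })
  where
  open CatalanSum ⌊_/2⌋ (λ j k _ → (j ∸ k) C k) (λ _ → refl)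
    (λ j → ℕₚ.⌊n/2⌋-mono (ℕₚ.n≤1+n (suc j)))
    (λ j _ → trans (nC0≡1 (suc (suc j))) (sym (nC0≡1 (suc j))))
    (λ j k _ k≤⌊j/2⌋ → pascal-∸ k (ℕₚ.≤-trans k≤⌊j/2⌋ (ℕₚ.⌊n/2⌋≤n j)))
    (λ j k _ → [n∸k]Ck-vanish (suc j))
  unit : ∀ c → 0ℚ + 1ℚ * 1ℚ * c ≡ c
  unit c = trans (+-identityˡ _) (*-identityˡ c)

-- The bracket in the formula for column `j+2`, with `i` standing for n-1-k.
Q-coefficient : ℕ → ℕ → ℕ → ℕ
Q-coefficient j k i = i ℕ.* ((suc j ∸ k) C k ℕ.+ b) ℕ.+ b
  where
  b : ℕ
  b = binom (j ∸ k) (+ k ℤ.- + 1)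

Q-coefficient-zero : ∀ j i → Q-coefficient (suc (suc j)) 0 i ≡ Q-coefficient (suc j) 0 i
Q-coefficient-zero j i = cong (λ a → i ℕ.* (a ℕ.+ 0) ℕ.+ 0)
  (trans (nC0≡1 (suc (suc (suc j)))) (sym (nC0≡1 (suc (suc j)))))

-- For fixed `i` the coefficient is linear in its two binomials, so Pascal's rule for each of them
-- suffices.
Q-coefficient-suc : ∀ j k i → k ≤ ⌊ suc j /2⌋ →
  Q-coefficient (suc (suc j)) (suc k) i ≡ Q-coefficient (suc j) (suc k) i ℕ.+ Q-coefficient j k i
Q-coefficient-suc j k i k≤ = trans
  (cong₂ (λ a b → i ℕ.* (a ℕ.+ b) ℕ.+ b) (pascal-∸ k (ℕₚ.≤-trans k≤ (ℕₚ.⌊n/2⌋≤n (suc j)))) (lower j k k≤))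
  (solve 5 (λ i a a′ b b′ → i :* ((a :+ a′) :+ (b :+ b′)) :+ (b :+ b′)
              := (i :* (a :+ b) :+ b) :+ (i :* (a′ :+ b′) :+ b′)) refl
    i ((suc j ∸ k) C suc k) ((suc j ∸ k) C k) ((j ∸ k) C k) (binom (j ∸ k) (+ k ℤ.- + 1)))
  where
  open ℕSolver.+-*-Solver
  -- At `k = 0` the convention binom(a, -1) = 0 takes the place of Pascal's rule.
  lower : ∀ j k → k ≤ ⌊ suc j /2⌋ → (suc j ∸ k) C k ≡ (j ∸ k) C k ℕ.+ binom (j ∸ k) (+ k ℤ.- + 1)
  lower j       zero    _        = trans (nC0≡1 (suc j)) (sym (trans (ℕₚ.+-identityʳ _) (nC0≡1 j)))
  lower (suc j) (suc k) (s≤s k≤) = pascal-∸ k (ℕₚ.≤-trans k≤ (ℕₚ.⌊n/2⌋≤n j))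

Q-coefficient-vanish : ∀ j k i → ⌊ suc (suc j) /2⌋ < k → Q-coefficient (suc j) k i ≡ 0
Q-coefficient-vanish j (suc k) i lt@(s≤s ⌊j/2⌋<k) = trans
  (cong₂ (λ a b → i ℕ.* (a ℕ.+ b) ℕ.+ b) ([n∸k]Ck-vanish (suc (suc j)) lt) ([n∸k]Ck-vanish j ⌊j/2⌋<k))
  (trans (ℕₚ.+-identityʳ _) (ℕₚ.*-zeroʳ i))

Q-columns : ∀ n j → suc (suc j) ≤ n → entry Q n (suc (suc j)) ≡ ∑[ k ≤ ⌊ suc j /2⌋ ]
  ((- 1ℚ) ^ k * fromℕ (Q-coefficient j k (n ∸ 1 ∸ k)) * catalan (n ∸ 1 ∸ k))
Q-columns = catalanSum-unique (λ n j → entry Q n (suc (suc j))) 2 (λ n j → Q-rec n (suc (suc j)))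
  (λ { (suc n) _ → trans (Q-column₂ n) (sym (first n)) })
  (λ { (suc zero) (s≤s ()) ; (suc (suc n)) _ → trans (Q-column₃ n) (sym (second n)) })
  where
  open CatalanSum (λ j → ⌊ suc j /2⌋) Q-coefficient (λ _ → refl)
    (λ j → ℕₚ.⌊n/2⌋-mono (ℕₚ.n≤1+n (suc (suc j))))
    Q-coefficient-zero Q-coefficient-suc Q-coefficient-vanish

  first : ∀ i → 0ℚ + 1ℚ * fromℕ (i ℕ.* 1 ℕ.+ 0) * catalan i ≡ fromℕ i * catalan i
  first i = trans (+-identityˡ _) (cong (_* catalan i)
    (trans (*-identityˡ _) (cong fromℕ (trans (ℕₚ.+-identityʳ _) (ℕₚ.*-identityʳ i)))))

  -- In column 3 the sum has two terms; at `k = 1` both binomials are 1, whence the weight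
  -- `n * 2 + 1`.
  second : ∀ n → 0ℚ + 1ℚ * fromℕ (suc n ℕ.* 1 ℕ.+ 0) * catalan (suc n) + - 1ℚ * fromℕ (n ℕ.* 2 ℕ.+ 1) * catalan n
    ≡ fromℕ (suc n) * catalan (suc n) + - ((1ℚ + (fromℕ n + fromℕ n)) * catalan n)
  second n = cong₂ _+_ (first (suc n)) (begin
    - 1ℚ * fromℕ (n ℕ.* 2 ℕ.+ 1) * catalan n
      ≡⟨ cong (λ m → - 1ℚ * fromℕ m * catalan n)
           (ℕSolver.+-*-Solver.solve 1 (λ n → n S.:* S.con 2 S.:+ S.con 1 S.:= S.con 1 S.:+ (n S.:+ n)) refl n) ⟩
    - 1ℚ * fromℕ (1 ℕ.+ (n ℕ.+ n)) * catalan n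
      ≡⟨ cong (λ x → - 1ℚ * x * catalan n) (trans (fromℕ-+ 1 (n ℕ.+ n)) (cong (_+_ 1ℚ) (fromℕ-+ n n))) ⟩
    - 1ℚ * (1ℚ + (fromℕ n + fromℕ n)) * catalan n
      ≡⟨ solve 2 (λ x c → :- con 1ℚ :* x :* c := :- (x :* c)) refl (1ℚ + (fromℕ n + fromℕ n)) (catalan n) ⟩
    - ((1ℚ + (fromℕ n + fromℕ n)) * catalan n)
      ∎)
    where
    module S = ℕSolver.+-*-Solver
    open +-*-Solver

theorem3p5 :
  let r = entry (D ⊡ 𝔽ˢ ⁻¹ ⊡ D)
      q = entry (D ⊡ 𝕃ˢ ⁻¹ ⊡ D)
  in
  ( r 0 0 ≡ catalan 0
  × (∀ n → r (suc n) 0 ≡ 0ℚ)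
  × (∀ n j → 1 ≤ j →
      (j ≤ n →
        r n j ≡ ∑[ k ≤ ⌊ j ∸ 1 /2⌋ ]
          ((- 1ℚ) ^ k * fromℕ (binom (j ∸ 1 ∸ k) (+ k)) * catalan (n ∸ 1 ∸ k)))
    × (n < j → r n j ≡ 0ℚ)))
  ×
  ( (∀ n → q n 0 ≡ fromℕ (n ℕ.+ 1) * catalan n)
  × (∀ n → 1 ≤ n → q n 1 ≡ fromℕ (2 ℕ.* n ∸ 1) * catalan (n ∸ 1))
  × (∀ n j → 2 ≤ j → j ≤ n →
        q n j ≡ ∑[ k ≤ ⌊ j ∸ 1 /2⌋ ]
          ((- 1ℚ) ^ k
            * fromℕ ((n ∸ 1 ∸ k) ℕ.* (binom (j ∸ 1 ∸ k) (+ k) ℕ.+ binom (j ∸ 2 ∸ k) (+ k ℤ.- + 1))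
                     ℕ.+ binom (j ∸ 2 ∸ k) (+ k ℤ.- + 1))
            * catalan (n ∸ 1 ∸ k))))
theorem3p5 =
  -- Both `entry R 0 0` and `catalan 0` compute to 1.
  ( 𝔽ˢ-entries 0 0
  , (λ n → trans (𝔽ˢ-entries (suc n) 0) (R-column₀ (suc n)))
  , λ { n (suc j) _ → (λ j≤n → trans (𝔽ˢ-entries n (suc j)) (R-columns n j j≤n))
                    , upper (D ⊡ 𝔽ˢ ⁻¹ ⊡ D) } )
  , (λ n → trans (𝕃ˢ-entries n 0) (central-column₀-catalan n))
  , (λ { (suc n) _ → trans (𝕃ˢ-entries (suc n) 1) (central-column₁-catalan n) })
  , λ { _ (suc zero) (s≤s ()) _
      ; n (suc (suc j)) _ j≤n → trans (𝕃ˢ-entries n (suc (suc j))) (Q-columns n j j≤n) }
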